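{- Let $\Delta$ be a formal definition and $\mathcal{O}$ a context structure of $\Delta$. Assume that the binary relation $\propto$ on the set $\mathrm{At}$ of defined domain atoms monotonically orders $\Delta$ in $\mathcal{O}$. Then terminal natural inductions of $\Delta$ in $\mathcal{O}$ that respect $\propto$ exist, and all of them converge to the same limit. Moreover, this limit is independent of $\propto$ (any relation that monotonically orders $\Delta$ in $\mathcal{O}$ yields the same limit): it is the structure safely defined by $\Delta$ in $\mathcal{O}$.
   Context: Formal definitions. A formal definition $\Delta$ is a set of rules $\forall\bar x\,(P(\bar t)\leftarrow\phi)$ with $\phi$ a first-order formula and $P(\bar t)$ an atomic formula whose predicate $P$ is not equality. Such a rule is shorthand for $\forall\bar y\,(P(\bar y)\leftarrow\exists\bar x(\bar y=\bar t\wedge\phi))$, so every rule is assumed of the form $\forall\bar x\,(P(\bar x)\leftarrow\phi)$ with $\bar x$ distinct variables. $\mathrm{def}(\Delta)$ is the set of predicates occurring in heads; $\mathrm{pars}(\Delta)$ is the set of all other non-logical symbols with free occurrences in $\Delta$. A context structure $\mathcal{O}$ of $\Delta$ is a $\mathrm{pars}(\Delta)$-structure; let $D$ be its domain. A defined domain atom is $P(\bar a)$ with $P\in\mathrm{def}(\Delta)$ of arity $n$ and $\bar a\in D^n$; $\mathrm{At}$ is the set of all of them. $\mathrm{def}(\Delta)$-structures with domain $D$ are identified with subsets of $\mathrm{At}$ (the set of their true atoms). $\mathfrak{A}\vdash_\Delta P(\bar a)$ ("$P(\bar a)$ is derivable from $\mathfrak{A}$") means that some rule $\forall\bar x(P(\bar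 x)\leftarrow\phi)$ of $\Delta$ has $\phi$ true for $\bar x:=\bar a$ in the structure combining $\mathcal{O}$ and $\mathfrak{A}$. $\mathfrak{A}$ is saturated (closed) on $S\subseteq\mathrm{At}$ if every $A\in S$ with $\mathfrak{A}\vdash_\Delta A$ belongs to $\mathfrak{A}$; $\mathfrak{A}$ is saturated (closed) if it is so on $\mathrm{At}$. Natural inductions. A natural induction of $\Delta$ in $\mathcal{O}$ from $\mathfrak{A}$ is a $\subseteq$-increasing sequence $\mathcal{N}=(\mathfrak{A}_\alpha)_{0\le\alpha\le\beta}$ ($\beta$ an ordinal) of subsets of $\mathrm{At}$ with $\mathfrak{A}_0=\mathfrak{A}$; $\mathfrak{A}_i\vdash_\Delta A$ for every $i+1\le\beta$ and every $A\in\mathfrak{A}_{i+1}\setminus\mathfrak{A}_i$ (then $A$ is said to be derived at stage $i$); and $\mathfrak{A}_\lambda=\bigcup_{\alpha<\lambda}\mathfrak{A}_\alpha$ for limit ordinals $\lambda\le\beta$. Its limit is $\lim(\mathcal{N})=\mathfrak{A}_\beta$. A natural induction without further qualification starts from $\emptyset$. It is terminal if its limit is saturated. Orders. For a binary relation $\propto$ on $\mathrm{At}$, write $A\prec_\propto B$ iff $A\propto B$ and not $B\propto A$, and $\mathfrak{A}|_{R A}=\mathfrak{A}\cap\{B: B\,R\,A\}$ for a relation $R$. $\propto$ is a monotone dependency relation of $\Delta$ in $\mathcal{O}$ if for all $A\in\mathrm{At}$ and $\mathfrak{A},\mathfrak{B}\subseteq\mathrm{At}$ with $\mathfrak{A}|_{\prec_\propto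 A}=\mathfrak{B}|_{\prec_\propto A}$ and $\mathfrak{A}|_{\propto A}\subseteq\mathfrak{B}|_{\propto A}$: $\mathfrak{A}\vdash_\Delta A$ implies $\mathfrak{B}\vdash_\Delta A$. $\propto$ monotonically orders $\Delta$ in $\mathcal{O}$ if $\propto$ is transitive, $\prec_\propto$ is a strict well-founded order, and $\propto$ is a monotone dependency relation of $\Delta$ in $\mathcal{O}$. A natural induction respects $\propto$ if whenever $A$ is derived at stage $i$, $\mathfrak{A}_i$ is saturated on $\{B: B\prec_\propto A\}$. Safety. $A\in\mathrm{At}$ is safely derivable from $\mathfrak{A}$ if $\mathfrak{A}\vdash_\Delta A$ and $\lim(\mathcal{N})\vdash_\Delta A$ for each natural induction $\mathcal{N}$ from $\mathfrak{A}$. A natural induction is safe if for each $\alpha<\beta$ every atom of $\mathfrak{A}_{\alpha+1}\setminus\mathfrak{A}_\alpha$ is safely derivable from $\mathfrak{A}_\alpha$. It is safe-terminal if it is safe and every atom safely derivable from its limit belongs to its limit. The structure safely defined by $\Delta$ in $\mathcal{O}$ is the limit of any safe-terminal natural induction of $\Delta$ in $\mathcal{O}$ (all of them have the same limit). -}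

module Defs where

open import Data.Empty.Polymorphic using (⊥)
open import Data.Fin.Base using (Fin)
open import Data.Nat.Base using (ℕ; suc)
open import Data.Product.Base using (Σ-syntax; ∃-syntax; _×_; _,_)
open import Data.Sum.Base using (_⊎_; inj₁; inj₂)
open import Data.Unit.Polymorphic using (⊤)
open import Data.Vec.Base using (Vec; []; _∷_; lookup)
open import Function.Base using (_∘_)
open import Induction.WellFounded using (WellFounded)
open import Level using (Level) renaming (suc to lsuc)
open import Relation.Binary.Bundles using (StrictTotalOrder)
open import Relation.Binary.Construct.StrictToNonStrict as ToNonStrict using ()
open import Relation.Binary.Core using (Rel)
open import Relation.Binary.Definitions using (Transitive)
open import Relation.Binary.PropositionalEquality.Core using (_≡_; refl)
open import Relation.Binary.Structures using (IsStrictPartialOrder)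
open import Relation.Nullary.Negation.Core using (¬_)
open import Relation.Unary using (Pred; _∈_; _∉_; _⊆_; _≐_; _∩_; _∖_; ∁)
open import Relation.Unary.Polymorphic using (∅)

------------------------------------------------------------------------
-- First-order syntax

-- Constants are function symbols of arity 0.  Object symbols that are free in
-- a rule without being bound by its prefix ∀x̄ are constants in this sense.

record Vocabulary (ℓ : Level) : Set (lsuc ℓ) where
  field
    FunSym    : Set ℓ
    PredSym   : Set ℓ
    funArity  : FunSym → ℕ
    predArity : PredSym → ℕ

open Vocabulary public

data Symbol {ℓ} (V : Vocabulary ℓ) : Set ℓ where
  fun  : FunSym V → Symbol V
  pred : PredSym V → Symbol V

data Term {ℓ} (V : Vocabulary ℓ) (n : ℕ) : Set ℓ where
  var : Fin n → Term V n
  app : (f : FunSym V) → Vec (Term V n) (funArity V f) → Term V n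

infix  8 _≈ᶠ_
infixr 7 _∧ᶠ_
infixr 6 _∨ᶠ_
infixr 5 _⇒ᶠ_

-- Formulas with n free variables, as de Bruijn indices.

data Formula {ℓ} (V : Vocabulary ℓ) : ℕ → Set ℓ where
  atomᶠ          : ∀ {n} (P : PredSym V) → Vec (Term V n) (predArity V P) → Formula V n
  _≈ᶠ_           : ∀ {n} → Term V n → Term V n → Formula V n
  ⊤ᶠ ⊥ᶠ          : ∀ {n} → Formula V n
  ¬ᶠ_            : ∀ {n} → Formula V n → Formula V n
  _∧ᶠ_ _∨ᶠ_ _⇒ᶠ_ : ∀ {n} → Formula V n → Formula V n → Formula V n
  ∀ᶠ_ ∃ᶠ_        : ∀ {n} → Formula V (suc n) → Formula V n

module _ {ℓ} {V : Vocabulary ℓ} (s : Symbol V) where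

  mutual
    OccursInTerm : ∀ {n} → Term V n → Set ℓ
    OccursInTerm (var x)    = ⊥
    OccursInTerm (app f ts) = s ≡ fun f ⊎ OccursInTerms ts

    OccursInTerms : ∀ {n k} → Vec (Term V n) k → Set ℓ
    OccursInTerms []       = ⊥
    OccursInTerms (t ∷ ts) = OccursInTerm t ⊎ OccursInTerms ts

  OccursIn : ∀ {n} → Formula V n → Set ℓ
  OccursIn (atomᶠ P ts) = s ≡ pred P ⊎ OccursInTerms ts
  OccursIn (t ≈ᶠ u)     = OccursInTerm t ⊎ OccursInTerm u
  OccursIn ⊤ᶠ           = ⊥
  OccursIn ⊥ᶠ           = ⊥
  OccursIn (¬ᶠ φ)       = OccursIn φ
  OccursIn (φ ∧ᶠ ψ)     = OccursIn φ ⊎ OccursIn ψ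
  OccursIn (φ ∨ᶠ ψ)     = OccursIn φ ⊎ OccursIn ψ
  OccursIn (φ ⇒ᶠ ψ)     = OccursIn φ ⊎ OccursIn ψ
  OccursIn (∀ᶠ φ)       = OccursIn φ
  OccursIn (∃ᶠ φ)       = OccursIn φ

------------------------------------------------------------------------
-- First-order semantics

-- A structure interpreting exactly the symbols in τ.  Membership in τ is an
-- irrelevant argument, so that an interpretation depends on the symbol only.

record Structure {ℓ} (V : Vocabulary ℓ) (τ : Pred (Symbol V) ℓ) : Set (lsuc ℓ) where
  field
    Domain : Set ℓ
    funᴵ   : ∀ f → .(fun f ∈ τ) → Vec Domain (funArity V f) → Domain
    predᴵ  : ∀ P → .(pred P ∈ τ) → Vec Domain (predArity V P) → Set ℓ

module _ {ℓ} {V : Vocabulary ℓ} {τ : Pred (Symbol V) ℓ} (M : Structure V τ) where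
  open Structure M

  mutual
    evalTerm : ∀ {n} (t : Term V n) → (λ s → OccursInTerm s t) ⊆ τ →
               Vec Domain n → Domain
    evalTerm (var x)    h ρ = lookup ρ x
    evalTerm (app f ts) h ρ = funᴵ f (h (inj₁ refl)) (evalTerms ts (h ∘ inj₂) ρ)

    evalTerms : ∀ {n k} (ts : Vec (Term V n) k) → (λ s → OccursInTerms s ts) ⊆ τ →
                Vec Domain n → Vec Domain k
    evalTerms []       h ρ = []
    evalTerms (t ∷ ts) h ρ = evalTerm t (h ∘ inj₁) ρ ∷ evalTerms ts (h ∘ inj₂) ρ

  Satisfies : ∀ {n} (φ : Formula V n) → (λ s → OccursIn s φ) ⊆ τ →
              Vec Domain n → Set ℓ
  Satisfies (atomᶠ P ts) h ρ = predᴵ P (h (inj₁ refl)) (evalTerms ts (h ∘ inj₂) ρ)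
  Satisfies (t ≈ᶠ u)     h ρ = evalTerm t (h ∘ inj₁) ρ ≡ evalTerm u (h ∘ inj₂) ρ
  Satisfies ⊤ᶠ           h ρ = ⊤
  Satisfies ⊥ᶠ           h ρ = ⊥
  Satisfies (¬ᶠ φ)       h ρ = ¬ Satisfies φ h ρ
  Satisfies (φ ∧ᶠ ψ)     h ρ = Satisfies φ (h ∘ inj₁) ρ × Satisfies ψ (h ∘ inj₂) ρ
  Satisfies (φ ∨ᶠ ψ)     h ρ = Satisfies φ (h ∘ inj₁) ρ ⊎ Satisfies ψ (h ∘ inj₂) ρ
  Satisfies (φ ⇒ᶠ ψ)     h ρ = Satisfies φ (h ∘ inj₁) ρ → Satisfies ψ (h ∘ inj₂) ρ
  Satisfies (∀ᶠ φ)       h ρ = ∀ d → Satisfies φ h (d ∷ ρ)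
  Satisfies (∃ᶠ φ)       h ρ = ∃[ d ] Satisfies φ h (d ∷ ρ)

------------------------------------------------------------------------
-- Formal definitions

-- The rule ∀x̄ (P(x̄) ← φ), with x̄ distinct variables: the free variables of φ
-- are the argument places of P.

record Rule {ℓ} (V : Vocabulary ℓ) : Set ℓ where
  field
    head : PredSym V
    body : Formula V (predArity V head)

open Rule public

FormalDefinition : ∀ {ℓ} → Vocabulary ℓ → Set (lsuc ℓ)
FormalDefinition {ℓ} V = Pred (Rule V) ℓ

module _ {ℓ} {V : Vocabulary ℓ} (Δ : FormalDefinition V) where

  symbols : Pred (Symbol V) ℓ
  symbols s = ∃[ r ] r ∈ Δ × (s ≡ pred (head r) ⊎ OccursIn s (body r))

  def : Pred (Symbol V) ℓ
  def s = ∃[ r ] r ∈ Δ × s ≡ pred (head r)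

  pars : Pred (Symbol V) ℓ
  pars = symbols ∩ ∁ def

  ContextStructure : Set (lsuc ℓ)
  ContextStructure = Structure V pars

-- Irrelevance of `defined` makes P(ā) a single atom, however many rules have P
-- in their head.

record At {ℓ} {V : Vocabulary ℓ} (Δ : FormalDefinition V)
          (𝒪 : ContextStructure Δ) : Set ℓ where
  constructor atom
  field
    predicate : PredSym V
    .defined  : pred predicate ∈ def Δ
    arguments : Vec (Structure.Domain 𝒪) (predArity V predicate)

------------------------------------------------------------------------
-- Ordinals

-- The set {α : 0 ≤ α ≤ β} of ordinals, for an ordinal β: a well-order with a
-- greatest element.  Indices are compared by the setoid equality of the order.

record OrdinalsUpTo (ℓ : Level) : Set (lsuc ℓ) where
  field
    strictTotalOrder : StrictTotalOrder ℓ ℓ ℓ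
  open StrictTotalOrder strictTotalOrder public
    using (_≈_; _<_) renaming (Carrier to Index)
  open ToNonStrict _≈_ _<_ public using (_≤_)
  field
    wellFounded : WellFounded _<_
    β           : Index
    β-greatest  : ∀ i → i ≤ β

  IsZero : Index → Set ℓ
  IsZero i = ∀ j → ¬ (j < i)

  IsSuccessorOf : Index → Index → Set ℓ
  IsSuccessorOf j i = i < j × (∀ k → ¬ (i < k × k < j))

  IsLimit : Index → Set ℓ
  IsLimit i = ¬ IsZero i × (∀ j → ¬ IsSuccessorOf i j)

------------------------------------------------------------------------
-- Derivability and natural inductions

module _ {ℓ} {V : Vocabulary ℓ} {Δ : FormalDefinition V} (𝒪 : ContextStructure Δ) where
  private module 𝒪 = Structure 𝒪

  AtomSet : Set (lsuc ℓ)
  AtomSet = Pred (At Δ 𝒪) ℓ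

  -- The structure combining 𝒪 and 𝔄: a predicate P ∈ def(Δ) is interpreted by
  -- the atoms in 𝔄, all other symbols by 𝒪.
  combine : AtomSet → Structure V (symbols Δ)
  combine 𝔄 = record
    { Domain = 𝒪.Domain
    ; funᴵ   = λ f s → 𝒪.funᴵ f (s , λ { (_ , _ , ()) })
    ; predᴵ  = λ P s ā → (Σ[ d ∈ pred P ∈ def Δ ] atom P d ā ∈ 𝔄)
                       ⊎ (Σ[ n ∈ pred P ∉ def Δ ] 𝒪.predᴵ P (s , n) ā)
    }

  bodySymbols : ∀ {r} → r ∈ Δ → (λ s → OccursIn s (body r)) ⊆ symbols Δ
  bodySymbols {r} r∈Δ o = r , r∈Δ , inj₂ o

  infix 4 _⊢_

  data _⊢_ (𝔄 : AtomSet) : At Δ 𝒪 → Set ℓ where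
    byRule : ∀ r (r∈Δ : r ∈ Δ) .{d : pred (head r) ∈ def Δ} ā →
             Satisfies (combine 𝔄) (body r) (bodySymbols r∈Δ) ā →
             𝔄 ⊢ atom (head r) d ā

  SaturatedOn : AtomSet → AtomSet → Set ℓ
  SaturatedOn S 𝔄 = ∀ {A} → A ∈ S → 𝔄 ⊢ A → A ∈ 𝔄

  Saturated : AtomSet → Set ℓ
  Saturated 𝔄 = ∀ {A} → 𝔄 ⊢ A → A ∈ 𝔄

  record NaturalInductionFrom (𝔄 : AtomSet) : Set (lsuc ℓ) where
    field
      ordinals : OrdinalsUpTo ℓ
    open OrdinalsUpTo ordinals public
    field
      stage      : Index → AtomSet
      increasing : ∀ {i j} → i ≤ j → stage i ⊆ stage j
      atZero     : ∀ {i} → IsZero i → stage i ≐ 𝔄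
      atSuc      : ∀ {i j} → IsSuccessorOf j i →
                   ∀ {A} → A ∈ stage j ∖ stage i → stage i ⊢ A
      atLimit    : ∀ {i} → IsLimit i → stage i ≐ (λ A → ∃[ j ] j < i × A ∈ stage j)

    lim : AtomSet
    lim = stage β

    DerivedAt : Index → At Δ 𝒪 → Set ℓ
    DerivedAt i A = ∃[ j ] IsSuccessorOf j i × A ∈ stage j ∖ stage i

  open NaturalInductionFrom public using (lim; stage; DerivedAt)

  NaturalInduction : Set (lsuc ℓ)
  NaturalInduction = NaturalInductionFrom ∅

  Terminal : NaturalInduction → Set ℓ
  Terminal 𝒩 = Saturated (lim 𝒩)

  ----------------------------------------------------------------------
  -- Orders on atoms

  module _ (_∝_ : Rel (At Δ 𝒪) ℓ) where

    StrictPart : Rel (At Δ 𝒪) ℓ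
    StrictPart A B = A ∝ B × ¬ (B ∝ A)

    private
      _≺_ : Rel (At Δ 𝒪) ℓ
      _≺_ = StrictPart

    MonotoneDependency : Set (lsuc ℓ)
    MonotoneDependency =
      ∀ A (𝔄 𝔅 : AtomSet) →
      𝔄 ∩ (_≺ A) ≐ 𝔅 ∩ (_≺ A) →
      𝔄 ∩ (_∝ A) ⊆ 𝔅 ∩ (_∝ A) →
      𝔄 ⊢ A → 𝔅 ⊢ A

    record MonotonicallyOrders : Set (lsuc ℓ) where
      field
        transitive         : Transitive _∝_
        strictOrder        : IsStrictPartialOrder _≡_ _≺_
        strictWellFounded  : WellFounded _≺_
        monotoneDependency : MonotoneDependency

    Respects : NaturalInduction → Set ℓ
    Respects 𝒩 = ∀ {i A} → DerivedAt 𝒩 i A → SaturatedOn (_≺ A) (stage 𝒩 i)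

  ----------------------------------------------------------------------
  -- Safety

  SafelyDerivableFrom : AtomSet → At Δ 𝒪 → Set (lsuc ℓ)
  SafelyDerivableFrom 𝔄 A = 𝔄 ⊢ A × ((𝒩 : NaturalInductionFrom 𝔄) → lim 𝒩 ⊢ A)

  Safe : NaturalInduction → Set (lsuc ℓ)
  Safe 𝒩 = ∀ {i A} → DerivedAt 𝒩 i A → SafelyDerivableFrom (stage 𝒩 i) A

  SafeTerminal : NaturalInduction → Set (lsuc ℓ)
  SafeTerminal 𝒩 = Safe 𝒩 × (∀ {A} → SafelyDerivableFrom (lim 𝒩) A → A ∈ lim 𝒩)

  -- "The limit of any safe-terminal natural induction" presupposes that there
  -- is one and that all of them have the same limit; both are part of this.
  IsSafelyDefinedStructure : AtomSet → Set (lsuc ℓ)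
  IsSafelyDefinedStructure 𝔄 =
    (∃[ 𝒩 ] SafeTerminal 𝒩 × lim 𝒩 ≐ 𝔄) × (∀ 𝒩 → SafeTerminal 𝒩 → lim 𝒩 ≐ 𝔄)

{-# OPTIONS --safe #-}
module Submission where

-- Let 𝒩 be a natural induction that respects ∝ and let A be derived at its
-- stage 𝔄.  Then 𝔄 is saturated on the atoms below A, and no natural induction
-- from 𝔄 ever adds an atom below A (`settled`): at the first moment such a B is
-- added, every C with C ∝ B is itself below A, so the current set agrees with 𝔄
-- on everything B depends on, B is derivable from 𝔄, and B was already in 𝔄.
-- Since ∝ is a monotone dependency relation, A therefore stays derivable in
-- every extension of 𝔄 with the same atoms below A (`⊢-mono`), in particular in
-- the limit of every natural induction from 𝔄.  So 𝒩 is safe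
-- (`respects⇒safe`), and if it is terminal, it is safe-terminal.
--
-- Let moreover 𝒩 be terminal with limit L, and let 𝒮 be safe.  By induction on
-- the stages 𝔅 of 𝒮, 𝔅 ⊆ L (`safe⊆lim`): the stages of 𝒩 with 𝔅 adjoined to
-- each form a natural induction from 𝔅 with limit L, because 𝔅 ⊆ L contributes
-- no new atoms below those that 𝒩 derives.  So an atom safely derivable from 𝔅
-- is derivable from L, hence in L.  If 𝒮 is even safe-terminal, then conversely
-- L ⊆ lim 𝒮 (`lim⊆safeTerminal`): when A is derived at a stage 𝔄 ⊆ lim 𝒮 of 𝒩,
-- the inclusions 𝔄 ⊆ lim 𝒮 ⊆ L force lim 𝒮 to agree with 𝔄 below A, so the
-- first paragraph applies to lim 𝒮 in place of 𝔄 and shows that A is safely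
-- derivable from lim 𝒮.  Thus L is the limit of every safe-terminal induction,
-- and in particular of every terminal one that respects another order.
--
-- For existence, iterate the operator that adds every atom A derivable from 𝔄
-- such that 𝔄 is saturated on the atoms below A.  A fixed point is saturated,
-- by well-founded induction on ≺ (`ready⊆⇒saturated`).  The iteration needs no
-- ordinals given in advance: as in Zermelo's and Bourbaki's treatment, the least
-- family of sets closed under the operator and under unions is well-ordered by
-- inclusion (`apart`, `wellFounded`), and serves as its own index set.
open import Defs
open import Axiom.ExcludedMiddle using (ExcludedMiddle)
open import Data.Bool.Base using (Bool; true)
open import Data.Empty using (⊥-elim)
open import Data.Product.Base using (∃-syntax; _×_; _,_; proj₁; proj₂; swap)
open import Data.Sum.Base using (_⊎_; inj₁; inj₂; [_,_]′)
open import Function.Base using (id; _∘_; case_of_)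
open import Induction.WellFounded using (Acc; acc; WellFounded)
open import Level using (Lift; lift; lower)
open import Relation.Binary.Bundles using (StrictTotalOrder)
open import Relation.Binary.Core using (Rel)
open import Relation.Binary.Definitions using (tri<; tri≈; tri>; Trichotomous)
open import Relation.Binary.PropositionalEquality.Core using (_≡_)
open import Relation.Nullary.Decidable using (yes; no; does; dec-true; decidable-stable)
open import Relation.Nullary.Negation.Core using (¬_; contradiction)
open import Relation.Unary using (Pred; _∈_; _∉_; _⊆_; _≐_; _∪_)
open import Relation.Unary.Polymorphic using (∅)

-- Transfinite iteration of an operator on subsets

-- The iteration, from the empty set, of the operator X ↦ X ∪ G X.
module Tower (em : ∀ {a} → ExcludedMiddle a) {ℓ g} {U : Set ℓ}
             (G : Pred U ℓ → Pred U g)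
             (G-resp : ∀ {X Y} → X ≐ Y → G X ⊆ G Y) where

  -- Pred U ℓ lies in a universe above ℓ, but the indices of a natural induction
  -- must form a type in Set ℓ.  By excluded middle, boolean characteristic
  -- functions represent all subsets of U, of any level, and form such a type.
  Code : Set ℓ
  Code = U → Bool

  -- The subset of U represented by a code.
  ⟦_⟧ : Code → Pred U ℓ
  ⟦ c ⟧ u = Lift ℓ (c u ≡ true)

  -- The characteristic function of a predicate.  It is also applied to
  -- predicates on Code, which gives small codes for families of sets.
  code : ∀ {p} {A : Set ℓ} → Pred A p → A → Bool
  code P a = does (em {P = P a})

  encode : ∀ {p} {A : Set ℓ} (P : Pred A p) {a} → a ∈ P → code P a ≡ true
  encode P {a} = dec-true (em {P = P a})

  decode : ∀ {p} {A : Set ℓ} (P : Pred A p) {a} → code P a ≡ true → a ∈ P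
  decode P {a} e with em {P = P a}
  decode P {a} e | yes p = p

  infix 4 _⊑_ _⊏_

  -- Inclusion and strict inclusion of the represented sets.
  _⊑_ _⊏_ : Rel Code ℓ
  c ⊑ d = ∀ u → u ∈ ⟦ c ⟧ → u ∈ ⟦ d ⟧
  c ⊏ d = c ⊑ d × ¬ (d ⊑ c)

  ⊑-trans : ∀ {c d e} → c ⊑ d → d ⊑ e → c ⊑ e
  ⊑-trans c⊑d d⊑e u = d⊑e u ∘ c⊑d u

  -- One step of the iteration; `next` is its code.
  Grown : Code → Pred U _
  Grown c = ⟦ c ⟧ ∪ G ⟦ c ⟧

  next : Code → Code
  next c = code (Grown c)

  -- The union of a family of sets; `⋃` is its code.
  Union : (Code → Bool) → Pred U ℓ
  Union P u = ∃[ c ] P c ≡ true × u ∈ ⟦ c ⟧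

  ⋃ : (Code → Bool) → Code
  ⋃ P = code (Union P)

  -- The tower: the least family closed under `next` and arbitrary unions.  The
  -- union of the empty family provides its least member, the empty set.
  data Reached : Pred Code ℓ where
    grow : ∀ {c} → Reached c → Reached (next c)
    join : ∀ (P : Code → Bool) → (∀ {c} → P c ≡ true → Reached c) → Reached (⋃ P)

  ⊑-next : ∀ c → c ⊑ next c
  ⊑-next c u u∈c = lift (encode (Grown c) (inj₁ u∈c))

  next-resp : ∀ {c d} → c ⊑ d → d ⊑ c → next c ⊑ next d
  next-resp {c} {d} c⊑d d⊑c u (lift e) = lift (encode (Grown d)
    ([ inj₁ ∘ c⊑d u , inj₂ ∘ G-resp ((λ {v} → c⊑d v) , (λ {v} → d⊑c v)) ]′ (decode (Grown c) e)))

  ⊑-⋃ : ∀ P {c} → P c ≡ true → c ⊑ ⋃ P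
  ⊑-⋃ P {c} Pc u u∈c = lift (encode (Union P) (c , Pc , u∈c))

  ⋃-⊑ : ∀ P {d} → (∀ {c} → P c ≡ true → c ⊑ d) → ⋃ P ⊑ d
  ⋃-⊑ P h u (lift e) with decode (Union P) e
  ... | c , Pc , u∈c = h Pc u u∈c

  -- The strong form of comparability that passes through the induction on the
  -- tower: no set of the tower lies strictly between d and next d.
  Apart : Rel Code ℓ
  Apart c d = c ⊑ d ⊎ next d ⊑ c

  ⋃-split : ∀ P {d} → (∀ {c} → P c ≡ true → Apart c d) →
            ⋃ P ⊑ d ⊎ (∃[ c ] P c ≡ true × next d ⊑ c)
  ⋃-split P {d} h with em {P = ∃[ c ] P c ≡ true × next d ⊑ c}
  ... | yes w = inj₂ w
  ... | no ¬w = inj₁ (⋃-⊑ P λ Pc →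
                  [ id , (λ n⊑c → contradiction (_ , Pc , n⊑c) ¬w) ]′ (h Pc))

  apart-⋃ : ∀ P {d} → (∀ {c} → P c ≡ true → Apart c d) → Apart (⋃ P) d
  apart-⋃ P h with ⋃-split P h
  ... | inj₁ ⋃⊑d            = inj₁ ⋃⊑d
  ... | inj₂ (c , Pc , n⊑c) = inj₂ (⊑-trans n⊑c (⊑-⋃ P Pc))

  -- The hypothesis with c and d exchanged is needed here, so `apart` runs a
  -- double induction: for a successor on the left, an inner induction on the
  -- right argument produces the exchanged instance.
  apart-next : ∀ {c d} → Apart c d → Apart d c → Apart (next c) d
  apart-next (inj₂ nd⊑c) _            = inj₂ (⊑-trans nd⊑c (⊑-next _))
  apart-next (inj₁ c⊑d)  (inj₂ nc⊑d)  = inj₁ nc⊑d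
  apart-next (inj₁ c⊑d)  (inj₁ d⊑c)   = inj₂ (next-resp d⊑c c⊑d)

  apart : ∀ {c d} → Reached c → Reached d → Apart c d
  apart (join P r)   y = apart-⋃ P λ Pc → apart (r Pc) y
  apart (grow {c} x) y = apart-next (apart x y) (flipped y)
    where
    flipped : ∀ {d} → Reached d → Apart d c
    flipped (grow y)   = apart-next (flipped y) (apart x y)
    flipped (join P r) = apart-⋃ P λ Pd → flipped (r Pd)

  total : ∀ {c d} → Reached c → Reached d → ¬ (c ⊑ d) → d ⊑ c
  total x y c⋢d with apart x y
  ... | inj₁ c⊑d  = contradiction c⊑d c⋢d
  ... | inj₂ nd⊑c = ⊑-trans (⊑-next _) nd⊑c

  next-⊑ : ∀ {c d} → Reached c → Reached d → c ⊏ d → next c ⊑ d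
  next-⊑ x y (_ , d⋢c) with apart y x
  ... | inj₁ d⊑c  = contradiction d⊑c d⋢c
  ... | inj₂ nc⊑d = nc⊑d

  -- A fixed point in the tower is its greatest element.
  ⊑-fixed : ∀ {c d} → Reached c → Reached d → next c ⊑ c → d ⊑ c
  ⊑-fixed x (join P r) nc⊑c = ⋃-⊑ P λ Pd → ⊑-fixed x (r Pd) nc⊑c
  ⊑-fixed x (grow y)   nc⊑c with apart x y
  ... | inj₁ c⊑d  = ⊑-trans (next-resp (⊑-fixed x y nc⊑c) c⊑d) nc⊑c
  ... | inj₂ nd⊑c = nd⊑c

  -- The well-order of the tower

  -- The sets of the tower index themselves, ordered by strict inclusion.
  Index : Set ℓ
  Index = ∃[ c ] Reached c

  setAt : Index → Pred U ℓ
  setAt (c , _) = ⟦ c ⟧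

  _≈_ _<_ : Rel Index ℓ
  (c , _) ≈ (d , _) = c ⊑ d × d ⊑ c
  (c , _) < (d , _) = c ⊏ d

  compare : Trichotomous _≈_ _<_
  compare (c , x) (d , y) with em {P = c ⊑ d} | em {P = d ⊑ c}
  ... | yes p | yes q = tri≈ (λ (_ , d⋢c) → d⋢c q) (p , q) (λ (_ , c⋢d) → c⋢d p)
  ... | yes p | no ¬q = tri< (p , ¬q) (λ (_ , d⊑c) → ¬q d⊑c) (λ (d⊑c , _) → ¬q d⊑c)
  ... | no ¬p | _     = tri> (λ (c⊑d , _) → ¬p c⊑d) (λ (c⊑d , _) → ¬p c⊑d) (total x y ¬p , ¬p)

  strictTotalOrder : StrictTotalOrder ℓ ℓ ℓ
  strictTotalOrder = record
    { Carrier = Index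
    ; _≈_ = _≈_
    ; _<_ = _<_
    ; isStrictTotalOrder = record
      { isStrictPartialOrder = record
        { isEquivalence = record
          { refl  = (λ _ → id) , (λ _ → id)
          ; sym   = λ (p , q) → q , p
          ; trans = λ (p , q) (p′ , q′) → ⊑-trans p p′ , ⊑-trans q′ q
          }
        ; irrefl = λ (_ , d⊑c) (_ , d⋢c) → d⋢c d⊑c
        ; trans = λ (p , q) (p′ , _) → ⊑-trans p p′ , λ r → q (⊑-trans p′ r)
        ; <-resp-≈ =
            (λ (p , q) (r , s) → ⊑-trans r p , λ t → s (⊑-trans p t))
          , (λ (p , q) (r , s) → ⊑-trans q r , λ t → s (⊑-trans t q))
        }
      ; compare = compare
      }
    }

  -- Non-strict inclusion suffices, since e ⊏ d ⊑ c implies e ⊏ c.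
  acc-⊑ : ∀ {i j} → proj₁ j ⊑ proj₁ i → Acc _<_ i → Acc _<_ j
  acc-⊑ j⊑i (acc rs) = acc λ (k⊑j , j⋢k) →
    rs (⊑-trans k⊑j j⊑i , λ i⊑k → j⋢k (⊑-trans j⊑i i⊑k))

  wellFounded : WellFounded _<_
  wellFounded (_ , x) = go x
    where
    go : ∀ {c} (x : Reached c) → Acc _<_ (c , x)
    go (grow x) = acc λ { {_ , y} (_ , next⋢d) →
      [ (λ d⊑c → acc-⊑ d⊑c (go x)) , (λ next⊑d → contradiction next⊑d next⋢d) ]′ (apart y x) }
    go (join P r) = acc λ { {_ , y} (_ , ⋃⋢d) →
      [ (λ ⋃⊑d → contradiction ⋃⊑d ⋃⋢d)
      , (λ (_ , Pc , nd⊑c) → acc-⊑ (⊑-trans (⊑-next _) nd⊑c) (go (r Pc)))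
      ]′ (⋃-split P λ Pc → apart (r Pc) y) }

  -- The union of a subfamily of the tower of any level.
  joinIndex : ∀ {p} (Q : Pred Code p) → Q ⊆ Reached → Index
  joinIndex Q h = ⋃ (code Q) , join (code Q) λ e → h (decode Q e)

  -- The last stage is the union of the whole tower.
  β : Index
  β = joinIndex Reached id

  ⊑-β : ∀ {c} → Reached c → c ⊑ proj₁ β
  ⊑-β x = ⊑-⋃ (code Reached) (encode Reached x)

  ordinals : OrdinalsUpTo ℓ
  ordinals = record
    { strictTotalOrder = strictTotalOrder
    ; wellFounded      = wellFounded
    ; β                = β
    ; β-greatest       = β-greatest
    }
    where
    β-greatest : ∀ i → i < β ⊎ i ≈ β
    β-greatest (c , x) with em {P = proj₁ β ⊑ c}
    ... | yes β⊑c = inj₂ (⊑-β x , β⊑c)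
    ... | no  β⋢c = inj₁ (⊑-β x , β⋢c)

  open OrdinalsUpTo ordinals using (IsZero; IsSuccessorOf; IsLimit; _≤_)

  increasing : ∀ i j → i ≤ j → setAt i ⊆ setAt j
  increasing _ _ (inj₁ (c⊑d , _)) = c⊑d _
  increasing _ _ (inj₂ (c⊑d , _)) = c⊑d _

  setAt-zero : ∀ i → IsZero i → ∀ {u} → u ∉ setAt i
  setAt-zero (c , x) zero-i u∈c = zero-i bottom (bottom⊑ c , λ c⊑⋃ → bottom-empty (c⊑⋃ _ u∈c))
    where
    none : Pred Code ℓ
    none = ∅
    bottom : Index
    bottom = joinIndex none λ ()
    bottom⊑ : ∀ d → proj₁ bottom ⊑ d
    bottom⊑ d = ⋃-⊑ (code none) λ {c} e → case decode none {c} e of λ ()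
    bottom-empty : ∀ {u} → u ∉ setAt bottom
    bottom-empty (lift e) with decode (Union (code none)) e
    ... | c , e′ , _ with () ← decode none {c} e′

  -- The successor of c in the order is next c, as c ⊏ next c ⊑ d whenever c ⊏ d.
  setAt-suc : ∀ i j → IsSuccessorOf j i → ∀ {u} → u ∈ setAt j → u ∉ setAt i → u ∈ G (setAt i)
  setAt-suc (c , x) (d , y) (c⊏d@(c⊑d , d⋢c) , nothingBetween) u∈d u∉c =
    [ (λ u∈c → contradiction u∈c u∉c) , id ]′ (decode (Grown c) (lower (d⊑next _ u∈d)))
    where
    c⊏next : c ⊏ next c
    c⊏next = ⊑-next c , λ nc⊑c → d⋢c (⊑-fixed x y nc⊑c)
    d⊑next : d ⊑ next c
    d⊑next with em {P = d ⊑ next c}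
    ... | yes p = p
    ... | no ¬p = contradiction (c⊏next , next-⊑ x y c⊏d , ¬p) (nothingBetween (next c , grow x))

  -- If the union of the sets strictly below c were smaller than c, then c would
  -- be its successor.
  setAt-limit : ∀ i → IsLimit i → ∀ {u} → u ∈ setAt i → ∃[ j ] j < i × u ∈ setAt j
  setAt-limit i@(c , x) (_ , notSuc) u∈c = below (c⊑sup _ u∈c)
    where
    Below : Pred Code ℓ
    Below d = Reached d × d ⊏ c
    sup : Index
    sup = joinIndex Below proj₁
    sup⊑c : proj₁ sup ⊑ c
    sup⊑c = ⋃-⊑ (code Below) λ e → proj₁ (proj₂ (decode Below e))
    c⊑sup : c ⊑ proj₁ sup
    c⊑sup with em {P = c ⊑ proj₁ sup}
    ... | yes p = p
    ... | no ¬p = ⊥-elim (notSuc sup ((sup⊑c , ¬p) ,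
      λ { (d , y) ((_ , d⋢sup) , d⊏c) → d⋢sup (⊑-⋃ (code Below) (encode Below (y , d⊏c))) }))
    below : ∀ {u} → u ∈ setAt sup → ∃[ j ] j < i × u ∈ setAt j
    below (lift e) with decode (Union (code Below)) e
    ... | d , e′ , u∈d = let y , d⊏c = decode Below e′ in (d , y) , d⊏c , u∈d

  β-closed : G (setAt β) ⊆ setAt β
  β-closed u∈G = ⊑-β (grow (proj₂ β)) _ (lift (encode (Grown (proj₁ β)) (inj₂ u∈G)))

-- Natural inductions

module Inductions (em : ∀ {a} → ExcludedMiddle a) {ℓ} {V : Vocabulary ℓ}
                  {Δ : FormalDefinition V} (𝒪 : ContextStructure Δ) where

  module _ {𝔄 : AtomSet 𝒪} (𝒩 : NaturalInductionFrom 𝒪 𝔄) where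
    open NaturalInductionFrom 𝒩 hiding (lim; stage; DerivedAt)
    open StrictTotalOrder strictTotalOrder using (compare; module Eq)

    below : ∀ {i} → ¬ IsZero i → ∃[ j ] j < i
    below {i} ¬zero = decidable-stable em λ none → ¬zero λ j j<i → none (j , j<i)

    -- Transfinite induction along the stages of 𝒩.
    lim⊆ : ∀ {s} (S : Pred (At Δ 𝒪) s) → 𝔄 ⊆ S →
           (∀ {i A} → DerivedAt 𝒩 i A → stage 𝒩 i ⊆ S → A ∈ S) →
           lim 𝒩 ⊆ S
    lim⊆ S 𝔄⊆S step = go (wellFounded β)
      where
      go : ∀ {i} → Acc _<_ i → stage 𝒩 i ⊆ S
      go {i} (acc rs) {A} A∈ with em {P = IsZero i}
      ... | yes zero-i = 𝔄⊆S (proj₁ (atZero zero-i) A∈)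
      ... | no ¬zero with em {P = ∃[ j ] IsSuccessorOf i j}
      ...   | no ¬suc = let j , j<i , A∈j = proj₁ (atLimit (¬zero , λ j s → ¬suc (j , s))) A∈
                        in go (rs j<i) A∈j
      ...   | yes (j , s) with em {P = A ∈ stage 𝒩 j}
      ...     | yes A∈j = go (rs (proj₁ s)) A∈j
      ...     | no  A∉j = step (i , s , A∈ , A∉j) (go (rs (proj₁ s)))

    start⊆ : ∀ i → 𝔄 ⊆ stage 𝒩 i
    start⊆ i = go (wellFounded i)
      where
      go : ∀ {i} → Acc _<_ i → 𝔄 ⊆ stage 𝒩 i
      go {i} (acc rs) A∈ with em {P = IsZero i}
      ... | yes zero-i = proj₂ (atZero zero-i) A∈
      ... | no ¬zero   = let j , j<i = below ¬zero in increasing (inj₁ j<i) (go (rs j<i) A∈)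

    start⊆lim : 𝔄 ⊆ lim 𝒩
    start⊆lim = start⊆ β

    derived⇒⊢ : ∀ {i A} → DerivedAt 𝒩 i A → _⊢_ 𝒪 (stage 𝒩 i) A
    derived⇒⊢ (_ , s , A∈) = atSuc s A∈

    -- Adding a fixed set 𝔅 to all stages of 𝒩 gives a natural induction from 𝔅
    -- with limit lim 𝒩 ∪ 𝔅, provided that the derivations of 𝒩 survive.
    adjoin : ∀ 𝔅 → 𝔄 ⊆ 𝔅 →
             (∀ {i A} → DerivedAt 𝒩 i A → A ∉ 𝔅 → _⊢_ 𝒪 (stage 𝒩 i ∪ 𝔅) A) →
             NaturalInductionFrom 𝒪 𝔅
    adjoin 𝔅 𝔄⊆𝔅 derive = record
      { ordinals   = ordinals
      ; stage      = λ i → stage 𝒩 i ∪ 𝔅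
      ; increasing = λ i≤j → [ inj₁ ∘ increasing i≤j , inj₂ ]′
      ; atZero     = λ z → [ 𝔄⊆𝔅 ∘ proj₁ (atZero z) , id ]′ , inj₂
      ; atSuc      = λ { {i} {j} s (inj₁ A∈j , A∉) → derive (j , s , A∈j , A∉ ∘ inj₁) (A∉ ∘ inj₂)
                       ; s (inj₂ A∈𝔅 , A∉) → contradiction (inj₂ A∈𝔅) A∉ }
      ; atLimit    = λ l →
          [ (λ A∈ → let j , j<i , A∈j = proj₁ (atLimit l) A∈ in j , j<i , inj₁ A∈j)
          , (λ A∈𝔅 → let j , j<i = below (proj₁ l) in j , j<i , inj₂ A∈𝔅) ]′
          , λ { (j , j<i , inj₁ A∈j) → inj₁ (increasing (inj₁ j<i) A∈j)
              ; (j , _   , inj₂ A∈𝔅) → inj₂ A∈𝔅 }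
      }

    -- An atom outside stage i that is derived at stage k is derived no earlier
    -- than i; otherwise stage i would contain the successor stage of k.
    later⊇ : ∀ {i k A} → DerivedAt 𝒩 k A → A ∉ stage 𝒩 i → stage 𝒩 i ⊆ stage 𝒩 k
    later⊇ {i} {k} (k⁺ , (_ , gap) , A∈k⁺ , _) A∉i with compare i k
    ... | tri< i<k _ _ = increasing (inj₁ i<k)
    ... | tri≈ _ i≈k _ = increasing (inj₂ i≈k)
    ... | tri> _ _ k<i with compare i k⁺
    ...   | tri< i<k⁺ _ _ = contradiction (k<i , i<k⁺) (gap i)
    ...   | tri≈ _ i≈k⁺ _ = contradiction (increasing (inj₂ (Eq.sym i≈k⁺)) A∈k⁺) A∉i
    ...   | tri> _ _ k⁺<i = contradiction (increasing (inj₁ k⁺<i) A∈k⁺) A∉i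

  -- Natural inductions that respect a monotone order

  module _ {_∝_ : Rel (At Δ 𝒪) ℓ} (orders : MonotonicallyOrders 𝒪 _∝_) where
    open MonotonicallyOrders orders

    infix 4 _≺_

    _≺_ : Rel (At Δ 𝒪) ℓ
    _≺_ = StrictPart 𝒪 _∝_

    ∝-≺ : ∀ {A B C} → A ∝ B → B ≺ C → A ≺ C
    ∝-≺ A∝B (B∝C , C∝̸B) = transitive A∝B B∝C , λ C∝A → C∝̸B (transitive C∝A A∝B)

    -- 𝔅 has no atoms below A beyond those of 𝔄.  For 𝔄 ⊆ 𝔅, the case of
    -- interest, this says that 𝔄 and 𝔅 have the same atoms below A.
    AgreeBelow : At Δ 𝒪 → AtomSet 𝒪 → AtomSet 𝒪 → Set ℓ
    AgreeBelow A 𝔄 𝔅 = ∀ {B} → B ≺ A → B ∈ 𝔅 → B ∈ 𝔄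

    -- With 𝔅 ⊆ 𝔄, this also says that derivability respects equality of sets.
    ⊢-mono : ∀ {A 𝔄 𝔅} → 𝔄 ⊆ 𝔅 → AgreeBelow A 𝔄 𝔅 → _⊢_ 𝒪 𝔄 A → _⊢_ 𝒪 𝔅 A
    ⊢-mono 𝔄⊆𝔅 agree = monotoneDependency _ _ _
      ((λ (B∈ , B≺A) → 𝔄⊆𝔅 B∈ , B≺A) , λ (B∈ , B≺A) → agree B≺A B∈ , B≺A)
      (λ (B∈ , B∝A) → 𝔄⊆𝔅 B∈ , B∝A)

    -- For B ≺ A derivability from 𝔅 is inherited by the smaller set 𝔄, because
    -- every C ∝ B lies below A, where the two sets agree.
    ⊢-below : ∀ {A B 𝔄 𝔅} → 𝔄 ⊆ 𝔅 → AgreeBelow A 𝔄 𝔅 → B ≺ A → _⊢_ 𝒪 𝔅 B → _⊢_ 𝒪 𝔄 B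
    ⊢-below 𝔄⊆𝔅 agree B≺A = monotoneDependency _ _ _
      ((λ (C∈ , C≺B) → agree (∝-≺ (proj₁ C≺B) B≺A) C∈ , C≺B) , λ (C∈ , C≺B) → 𝔄⊆𝔅 C∈ , C≺B)
      (λ (C∈ , C∝B) → agree (∝-≺ C∝B B≺A) C∈ , C∝B)

    saturated-agree : ∀ {A 𝔄 𝔅} → 𝔄 ⊆ 𝔅 → AgreeBelow A 𝔄 𝔅 →
                      SaturatedOn 𝒪 (_≺ A) 𝔄 → SaturatedOn 𝒪 (_≺ A) 𝔅
    saturated-agree 𝔄⊆𝔅 agree sat B≺A 𝔅⊢B = 𝔄⊆𝔅 (sat B≺A (⊢-below 𝔄⊆𝔅 agree B≺A 𝔅⊢B))

    -- No natural induction from a set saturated below A adds an atom below A.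
    settled : ∀ {A 𝔄} → SaturatedOn 𝒪 (_≺ A) 𝔄 → (ℳ : NaturalInductionFrom 𝒪 𝔄) →
              AgreeBelow A 𝔄 (lim ℳ)
    settled {A} {𝔄} sat ℳ B≺A B∈ = lim⊆ ℳ (λ B → B ≺ A → B ∈ 𝔄) (λ B∈𝔄 _ → B∈𝔄)
      (λ {i} derived ih C≺A → sat C≺A
        (⊢-below (start⊆ ℳ i) (λ D≺A D∈ → ih D∈ D≺A) C≺A (derived⇒⊢ ℳ derived)))
      B∈ B≺A

    -- The part of 𝒩 from stage i on.  Instead of restricting the ordinals, the
    -- stages before i are padded to stage i.
    tail : ∀ (𝒩 : NaturalInduction 𝒪) i → NaturalInductionFrom 𝒪 (stage 𝒩 i)
    tail 𝒩 i = adjoin 𝒩 (stage 𝒩 i) (λ ())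
      λ derived A∉ → ⊢-mono inj₁ (λ _ → [ id , later⊇ 𝒩 derived A∉ ]′) (derived⇒⊢ 𝒩 derived)

    module _ (𝒩 : NaturalInduction 𝒪) (respects : Respects 𝒪 _∝_ 𝒩) where

      lim-agrees : ∀ {i A} → DerivedAt 𝒩 i A → AgreeBelow A (stage 𝒩 i) (lim 𝒩)
      lim-agrees {i} derived B≺A B∈ =
        settled (respects derived) (tail 𝒩 i) B≺A (inj₁ B∈)

      respects⇒safe : Safe 𝒪 𝒩
      respects⇒safe derived = derived⇒⊢ 𝒩 derived , λ ℳ →
        ⊢-mono (start⊆lim ℳ) (settled (respects derived) ℳ) (derived⇒⊢ 𝒩 derived)

      module _ (terminal : Terminal 𝒪 𝒩) where

        respects⇒safeTerminal : SafeTerminal 𝒪 𝒩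
        respects⇒safeTerminal = respects⇒safe , λ (lim⊢A , _) → terminal lim⊢A

        -- The limit of 𝒩 is also reached by a natural induction from each stage
        -- of 𝒮, and that induction is what safety of 𝒮 is applied to.
        safe⊆lim : ∀ 𝒮 → Safe 𝒪 𝒮 → lim 𝒮 ⊆ lim 𝒩
        safe⊆lim 𝒮 safe = lim⊆ 𝒮 (lim 𝒩) (λ ())
          (λ {j} derived 𝒮ⱼ⊆lim →
            let ℳ = adjoin 𝒩 (stage 𝒮 j) (λ ()) λ derivedᵢ _ →
                      ⊢-mono inj₁
                        (λ B≺A → [ id , (λ B∈ → lim-agrees derivedᵢ B≺A (𝒮ⱼ⊆lim B∈)) ]′)
                        (derived⇒⊢ 𝒩 derivedᵢ)
            in terminal (⊢-ext [ id , 𝒮ⱼ⊆lim ]′ inj₁ (proj₂ (safe derived) ℳ)))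
          where
          -- The limit of the adjoined induction is lim 𝒩 ∪ 𝔅 for the stage 𝔅 of
          -- 𝒮, which equals lim 𝒩 only up to mutual inclusion.
          ⊢-ext : ∀ {A 𝔄 𝔅} → 𝔄 ⊆ 𝔅 → 𝔅 ⊆ 𝔄 → _⊢_ 𝒪 𝔄 A → _⊢_ 𝒪 𝔅 A
          ⊢-ext p q = ⊢-mono p (λ _ → q)

        -- Each atom derived by 𝒩 is safely derivable from lim 𝒮, which by
        -- safe⊆lim lies between the stages of 𝒩 reached so far and lim 𝒩.
        lim⊆safeTerminal : ∀ 𝒮 → SafeTerminal 𝒪 𝒮 → lim 𝒩 ⊆ lim 𝒮
        lim⊆safeTerminal 𝒮 (safe , maximal) = lim⊆ 𝒩 (lim 𝒮) (λ ())
          (λ {i} {A} derived 𝒩ᵢ⊆lim →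
            let agree : AgreeBelow A (stage 𝒩 i) (lim 𝒮)
                agree B≺A B∈ = lim-agrees derived B≺A (safe⊆lim 𝒮 safe B∈)
                lim⊢A = ⊢-mono 𝒩ᵢ⊆lim agree (derived⇒⊢ 𝒩 derived)
                sat = saturated-agree 𝒩ᵢ⊆lim agree (respects derived)
            in maximal (lim⊢A , λ ℳ →
                 ⊢-mono (start⊆lim ℳ) (settled sat ℳ) lim⊢A))

        safeTerminal≐lim : ∀ 𝒮 → SafeTerminal 𝒪 𝒮 → lim 𝒮 ≐ lim 𝒩
        safeTerminal≐lim 𝒮 st = safe⊆lim 𝒮 (proj₁ st) , lim⊆safeTerminal 𝒮 st

    -- Existence

    -- The atoms that a natural induction respecting ∝ may derive from 𝔄.
    Ready : AtomSet 𝒪 → AtomSet 𝒪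
    Ready 𝔄 A = _⊢_ 𝒪 𝔄 A × SaturatedOn 𝒪 (_≺ A) 𝔄

    ready-resp : ∀ {𝔄 𝔅} → 𝔄 ≐ 𝔅 → Ready 𝔄 ⊆ Ready 𝔅
    ready-resp (𝔄⊆𝔅 , 𝔅⊆𝔄) (𝔄⊢A , sat) =
      ⊢-mono 𝔄⊆𝔅 (λ _ → 𝔅⊆𝔄) 𝔄⊢A , saturated-agree 𝔄⊆𝔅 (λ _ → 𝔅⊆𝔄) sat

    ready⊆⇒saturated : ∀ 𝔄 → Ready 𝔄 ⊆ 𝔄 → Saturated 𝒪 𝔄
    ready⊆⇒saturated 𝔄 closed {A} = go (strictWellFounded A)
      where
      go : ∀ {A} → Acc _≺_ A → _⊢_ 𝒪 𝔄 A → A ∈ 𝔄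
      go (acc rs) 𝔄⊢A = closed (𝔄⊢A , λ B≺A → go (rs B≺A))

    open Tower em Ready ready-resp
      renaming (setAt to towerStage; ordinals to towerOrdinals; increasing to towerIncreasing)
      using (setAt-zero; setAt-suc; setAt-limit; β-closed)

    -- The induction that derives all ready atoms at every stage.
    canonical : NaturalInduction 𝒪
    canonical = record
      { ordinals   = towerOrdinals
      ; stage      = towerStage
      ; increasing = λ {i} {j} → towerIncreasing i j
      ; atZero     = λ {i} z → (λ A∈ → contradiction A∈ (setAt-zero i z)) , λ ()
      ; atSuc      = λ {i} {j} s (A∈ , A∉) → proj₁ (setAt-suc i j s A∈ A∉)
      ; atLimit    = λ {i} l → setAt-limit i l , λ (j , j<i , A∈) → towerIncreasing j i (inj₁ j<i) A∈
      }

    terminalRespectful : ∃[ 𝒩 ] Terminal 𝒪 𝒩 × Respects 𝒪 _∝_ 𝒩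
    terminalRespectful =
        canonical
      , ready⊆⇒saturated (lim canonical) β-closed
      , λ {i} (j , s , A∈ , A∉) → proj₂ (setAt-suc i j s A∈ A∉)

theorem5p7 : (∀ {a} → ExcludedMiddle a) →
    ∀ {ℓ} {V : Vocabulary ℓ} (Δ : FormalDefinition V) (𝒪 : ContextStructure Δ)
    (_∝_ : Rel (At Δ 𝒪) ℓ) → MonotonicallyOrders 𝒪 _∝_ →
    (∃[ 𝒩 ] Terminal 𝒪 𝒩 × Respects 𝒪 _∝_ 𝒩)
    × (∀ 𝒩 𝒩′ → Terminal 𝒪 𝒩 → Respects 𝒪 _∝_ 𝒩 →
    Terminal 𝒪 𝒩′ → Respects 𝒪 _∝_ 𝒩′ → lim 𝒩 ≐ lim 𝒩′)
    × (∀ (_∝′_ : Rel (At Δ 𝒪) ℓ) → MonotonicallyOrders 𝒪 _∝′_ →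
    ∀ 𝒩 𝒩′ → Terminal 𝒪 𝒩 → Respects 𝒪 _∝_ 𝒩 →
    Terminal 𝒪 𝒩′ → Respects 𝒪 _∝′_ 𝒩′ → lim 𝒩 ≐ lim 𝒩′)
    × (∀ 𝒩 → Terminal 𝒪 𝒩 → Respects 𝒪 _∝_ 𝒩 →
    IsSafelyDefinedStructure 𝒪 (lim 𝒩))
theorem5p7 em Δ 𝒪 _∝_ orders =
    terminalRespectful orders
  , sameLimit orders
  , (λ _ orders′ → sameLimit orders′)
  , λ 𝒩 t r → (𝒩 , respects⇒safeTerminal orders 𝒩 r t , id , id) , safeTerminal≐lim orders 𝒩 r t
  where
  open Inductions em 𝒪
  sameLimit : ∀ {_∝′_} → MonotonicallyOrders 𝒪 _∝′_ →
              ∀ 𝒩 𝒩′ → Terminal 𝒪 𝒩 → Respects 𝒪 _∝_ 𝒩 →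
              Terminal 𝒪 𝒩′ → Respects 𝒪 _∝′_ 𝒩′ → lim 𝒩 ≐ lim 𝒩′
  sameLimit orders′ 𝒩 𝒩′ t r t′ r′ =
    swap (safeTerminal≐lim orders 𝒩 r t 𝒩′ (respects⇒safeTerminal orders′ 𝒩′ r′ t′))
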